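{- The following equalities of functions hold, where each $\mathrm{id}$ is the identity on the appropriate domain: $$\mathrm{nat2set}\circ\mathrm{set2nat}=\mathrm{id}_{\mathcal{P}_{\mathrm{fin}}(\mathbb{N})},\qquad \mathrm{set2nat}\circ\mathrm{nat2set}=\mathrm{id}_{\mathbb{N}},$$ $$\mathrm{nat2hfs}\circ\mathrm{hfs2nat}=\mathrm{id}_{HFS},\qquad \mathrm{hfs2nat}\circ\mathrm{nat2hfs}=\mathrm{id}_{\mathbb{N}}.$$
   Context: $\mathbb{N}=\{0,1,2,\dots\}$ and $\mathcal{P}_{\mathrm{fin}}(\mathbb{N})$ is the set of finite subsets of $\mathbb{N}$. Define $\mathrm{set2nat}:\mathcal{P}_{\mathrm{fin}}(\mathbb{N})\to\mathbb{N}$ by $\mathrm{set2nat}(X)=\sum_{x\in X}2^x$, and $\mathrm{nat2set}:\mathbb{N}\to\mathcal{P}_{\mathrm{fin}}(\mathbb{N})$ by letting $\mathrm{nat2set}(n)$ be the set of positions $i\ge 0$ at which the binary expansion of $n$ has digit $1$ (position $0$ is the least significant). Fix a constant $U\in\mathbb{N}$ (the paper's default value is $U=0$, giving pure sets). $HFS$ is the universe of hereditarily finite sets with urelements $0,1,\dots,U-1$: the inductively defined collection whose elements are either one of the $U$ urelements (atomic objects with no elements, distinct from all sets, including the empty set) or a finite (possibly empty) set of elements of $HFS$. $\mathrm{hfs2nat}:HFS\to\mathbb{N}$ is defined recursively by $\mathrm{hfs2nat}(a)=a$ for a urelement $a\in\{0,\dots,U-1\}$ and $\mathrm{hfs2nat}(x)=U+\mathrm{set2nat}(\{\mathrm{hfs2nat}(y):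 y\in x\})$ for a set $x$. $\mathrm{nat2hfs}:\mathbb{N}\to HFS$ is defined recursively by $\mathrm{nat2hfs}(n)=n$ (the urelement $n$) if $n<U$, and $\mathrm{nat2hfs}(n)=\{\mathrm{nat2hfs}(m): m\in\mathrm{nat2set}(n-U)\}$ if $n\ge U$ (every $m\in\mathrm{nat2set}(n-U)$ satisfies $m<n$, so the recursion is well-founded). -}

module Defs where

open import Data.Digit using (Expansion; 1b; fromDigits; toDigits)
open import Data.Fin.Base as Fin using (Fin; toℕ; fromℕ<)
import Data.Fin.Properties as Fin
open import Data.List.Base using (List; []; _∷_; map; deduplicate; findIndices)
open import Data.List.Membership.Propositional using (_∈_; mapWith∈)
open import Data.List.Membership.Propositional.Properties
  using (deduplicate-∈⇔; ∈-map⁻; ∈-map⁺; mapWith∈-cong; mapWith∈≗map)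
open import Data.List.Membership.Propositional.Properties.WithK
  using (unique∧set⇒bag)
open import Data.List.Relation.Binary.BagAndSetEquality
  using (set; [_]-Equality; _∼[_]_; ∼bag⇒↭)
open import Data.List.Relation.Binary.Permutation.Propositional.Properties
  using (map⁺)
open import Data.List.Relation.Unary.All as All using (All; []; _∷_)
open import Data.List.Relation.Unary.Any using (here; there)
open import Data.List.Relation.Unary.Unique.DecPropositional.Properties
  using (deduplicate-!)
open import Data.Nat.Base
open import Data.Nat.Induction using (<-wellFounded; <-rec)
open import Data.Nat.ListAction using (sum)
open import Data.Nat.ListAction.Properties using (sum-↭)
open import Data.Nat.Properties
open import Data.Product.Base using (∃; _×_; _,_; proj₁; proj₂)
open import Function.Bundles using (Func; mk⇔)
import Function.Construct.Composition as Composition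
import Function.Construct.Identity as Identity
import Function.Properties.Equivalence as ⇔
import Function.Relation.Binary.Setoid.Equality as FunctionEquality
open import Induction.WellFounded using (module FixPoint)
open import Level using (0ℓ)
open import Relation.Binary.Bundles using (Setoid)
open import Relation.Binary.PropositionalEquality
  using (_≡_; refl; sym; cong; subst; setoid; module ≡-Reasoning)
open import Relation.Nullary using (yes; no; contradiction)

private
  variable
    A B C : Setoid 0ℓ 0ℓ

infixr 9 _∘ₛ_
_∘ₛ_ : Func B C → Func A B → Func A C
g ∘ₛ f = Composition.function f g

idₛ : (A : Setoid 0ℓ 0ℓ) → Func A A
idₛ = Identity.function

infix 4 _≗ₛ_
_≗ₛ_ : Func A B → Func A B → Set
_≗ₛ_ {A} {B} = FunctionEquality._≈_ A B

ℕₛ : Setoid 0ℓ 0ℓ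
ℕₛ = setoid ℕ

-- A finite set is a list of its elements; two lists are equal when they
-- have the same members, so order and repetitions are immaterial.

Pfinₛ : Setoid 0ℓ 0ℓ
Pfinₛ = [ set ]-Equality ℕ

-- Repetitions are removed so that every element contributes once.

set2nat : List ℕ → ℕ
set2nat xs = sum (map (2 ^_) (deduplicate _≟_ xs))

set2nat-cong : ∀ {xs ys} → xs ∼[ set ] ys → set2nat xs ≡ set2nat ys
set2nat-cong {xs} {ys} xs∼ys =
  sum-↭ (map⁺ (2 ^_) (∼bag⇒↭
    (unique∧set⇒bag (deduplicate-! _≟_ xs) (deduplicate-! _≟_ ys)
      (⇔.trans (⇔.sym (deduplicate-∈⇔ _≟_)) (⇔.trans xs∼ys (deduplicate-∈⇔ _≟_))))))

set2natₛ : Func Pfinₛ ℕₛ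
set2natₛ = record { to = set2nat ; cong = set2nat-cong }

ones : Expansion 2 → List ℕ
ones ds = map toℕ (findIndices (Fin._≟ 1b) ds)

-- toDigits lists the least significant digit first.

nat2set : ℕ → List ℕ
nat2set n = ones (proj₁ (toDigits 2 n))

nat2setₛ : Func ℕₛ Pfinₛ
nat2setₛ = record { to = nat2set ; cong = λ { refl → ⇔.refl } }

mutual
  ∈-ones⇒2^≤ : ∀ ds {m} → m ∈ ones ds → 2 ^ m ≤ fromDigits ds
  ∈-ones⇒2^≤ (d ∷ ds) m∈ with d Fin.≟ 1b
  ∈-ones⇒2^≤ (d ∷ ds) (here refl) | yes refl = s≤s z≤n
  ∈-ones⇒2^≤ (d ∷ ds) (there m∈)  | yes _    = ∈-ones-tail⇒2^≤ d ds m∈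
  ∈-ones⇒2^≤ (d ∷ ds) m∈          | no _     = ∈-ones-tail⇒2^≤ d ds m∈

  ∈-ones-tail⇒2^≤ : ∀ d ds {m} →
                    m ∈ map toℕ (map Fin.suc (findIndices (Fin._≟ 1b) ds)) →
                    2 ^ m ≤ fromDigits (d ∷ ds)
  ∈-ones-tail⇒2^≤ d ds m∈ with ∈-map⁻ toℕ m∈
  ... | _ , i∈ , refl with ∈-map⁻ Fin.suc i∈
  ... | j , j∈ , refl = begin
    2 * 2 ^ toℕ j              ≡⟨ *-comm 2 (2 ^ toℕ j) ⟩
    2 ^ toℕ j * 2              ≤⟨ *-monoˡ-≤ 2 (∈-ones⇒2^≤ ds (∈-map⁺ toℕ j∈)) ⟩
    fromDigits ds * 2          ≤⟨ m≤n+m _ (toℕ d) ⟩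
    toℕ d + fromDigits ds * 2  ∎
    where open ≤-Reasoning

n<2^n : ∀ n → n < 2 ^ n
n<2^n zero    = s≤s z≤n
n<2^n (suc n) = begin-strict
  suc n                ≤⟨ n<2^n n ⟩
  2 ^ n                <⟨ m<m+n (2 ^ n) (m^n>0 2 n) ⟩
  2 ^ n + 2 ^ n        ≡⟨ cong (2 ^ n +_) (+-identityʳ (2 ^ n)) ⟨
  2 ^ n + (2 ^ n + 0)  ∎
  where open ≤-Reasoning

∈-nat2set⇒< : ∀ n {m} → m ∈ nat2set n → m < n
∈-nat2set⇒< n {m} m∈ = <-≤-trans (n<2^n m)
  (subst (2 ^ m ≤_) (proj₂ (toDigits 2 n)) (∈-ones⇒2^≤ (proj₁ (toDigits 2 n)) m∈))

data HFS (U : ℕ) : Set where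
  urelement : Fin U → HFS U
  finset    : List (HFS U) → HFS U

private
  variable
    U : ℕ

mutual
  HFS-ind : (P : HFS U → Set) →
            (∀ a → P (urelement a)) →
            (∀ xs → All P xs → P (finset xs)) →
            ∀ x → P x
  HFS-ind P u f (urelement a) = u a
  HFS-ind P u f (finset xs)   = f xs (HFS-ind* P u f xs)

  HFS-ind* : (P : HFS U → Set) →
             (∀ a → P (urelement a)) →
             (∀ xs → All P xs → P (finset xs)) →
             ∀ xs → All P xs
  HFS-ind* P u f []       = []
  HFS-ind* P u f (x ∷ xs) = HFS-ind P u f x ∷ HFS-ind* P u f xs

-- Extensional equality: as for finite sets of numbers, order and
-- repetitions in the list of elements are immaterial, at every depth.

infix 4 _≈_
data _≈_ {U : ℕ} : HFS U → HFS U → Set where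
  urelement : ∀ a → urelement a ≈ urelement a
  finset    : ∀ {xs ys} →
              (∀ {x} → x ∈ xs → ∃ λ y → y ∈ ys × x ≈ y) →
              (∀ {y} → y ∈ ys → ∃ λ x → x ∈ xs × x ≈ y) →
              finset xs ≈ finset ys

≈-refl : (x : HFS U) → x ≈ x
≈-refl = HFS-ind _ urelement λ xs ih → finset
  (λ x∈ → _ , x∈ , All.lookup ih x∈)
  (λ x∈ → _ , x∈ , All.lookup ih x∈)

≈-sym : (x : HFS U) → ∀ {y} → x ≈ y → y ≈ x
≈-sym = HFS-ind _ (λ { _ (urelement a) → urelement a }) λ where
  xs ih (finset f g) → finset
    (λ y∈ → let x , x∈ , x≈y = g y∈ in x , x∈ , All.lookup ih x∈ x≈y)
    (λ x∈ → let y , y∈ , x≈y = f x∈ in y , y∈ , All.lookup ih x∈ x≈y)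

≈-trans : (x : HFS U) → ∀ {y z} → x ≈ y → y ≈ z → x ≈ z
≈-trans = HFS-ind _ (λ { _ (urelement a) y≈z → y≈z }) λ where
  xs ih (finset f g) (finset h k) → finset
    (λ x∈ → let y , y∈ , x≈y = f x∈
                z , z∈ , y≈z = h y∈
            in z , z∈ , All.lookup ih x∈ x≈y y≈z)
    (λ z∈ → let y , y∈ , y≈z = k z∈
                x , x∈ , x≈y = g y∈
            in x , x∈ , All.lookup ih x∈ x≈y y≈z)

HFSₛ : ℕ → Setoid 0ℓ 0ℓ
HFSₛ U = record
  { Carrier       = HFS U
  ; _≈_           = _≈_
  ; isEquivalence = record
    { refl  = λ {x} → ≈-refl x
    ; sym   = λ {x} → ≈-sym x
    ; trans = λ {x} → ≈-trans x
    }
  }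

-- hfs2nat* is map hfs2nat, inlined for the termination checker.

mutual
  hfs2nat : HFS U → ℕ
  hfs2nat     (urelement a) = toℕ a
  hfs2nat {U} (finset xs)   = U + set2nat (hfs2nat* xs)

  hfs2nat* : List (HFS U) → List ℕ
  hfs2nat* []       = []
  hfs2nat* (x ∷ xs) = hfs2nat x ∷ hfs2nat* xs

hfs2nat*≡map : (xs : List (HFS U)) → hfs2nat* xs ≡ map hfs2nat xs
hfs2nat*≡map []       = refl
hfs2nat*≡map (x ∷ xs) = cong (hfs2nat x ∷_) (hfs2nat*≡map xs)

hfs2nat-finset : (xs : List (HFS U)) →
                 hfs2nat (finset xs) ≡ U + set2nat (map hfs2nat xs)
hfs2nat-finset {U} xs = cong (λ ns → U + set2nat ns) (hfs2nat*≡map xs)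

hfs2nat-cong : (x : HFS U) → ∀ {y} → x ≈ y → hfs2nat x ≡ hfs2nat y
hfs2nat-cong {U} = HFS-ind _ (λ { _ (urelement a) → refl }) step
  where
  step : ∀ xs → All (λ x → ∀ {y} → x ≈ y → hfs2nat x ≡ hfs2nat y) xs →
         ∀ {y} → finset xs ≈ y → hfs2nat (finset xs) ≡ hfs2nat y
  step xs ih (finset {ys = ys} f g) = begin
    hfs2nat (finset xs)           ≡⟨ hfs2nat-finset xs ⟩
    U + set2nat (map hfs2nat xs)  ≡⟨ cong (U +_) (set2nat-cong (mk⇔ to from)) ⟩
    U + set2nat (map hfs2nat ys)  ≡⟨ hfs2nat-finset ys ⟨
    hfs2nat (finset ys)           ∎
    where
    open ≡-Reasoning

    to : ∀ {n} → n ∈ map hfs2nat xs → n ∈ map hfs2nat ys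
    to n∈ with ∈-map⁻ hfs2nat n∈
    ... | x , x∈ , refl with f x∈
    ... | y , y∈ , x≈y =
      subst (_∈ map hfs2nat ys) (sym (All.lookup ih x∈ x≈y)) (∈-map⁺ hfs2nat y∈)

    from : ∀ {n} → n ∈ map hfs2nat ys → n ∈ map hfs2nat xs
    from n∈ with ∈-map⁻ hfs2nat n∈
    ... | y , y∈ , refl with g y∈
    ... | x , x∈ , x≈y =
      subst (_∈ map hfs2nat xs) (All.lookup ih x∈ x≈y) (∈-map⁺ hfs2nat x∈)

hfs2natₛ : ∀ U → Func (HFSₛ U) ℕₛ
hfs2natₛ U = record { to = hfs2nat ; cong = λ {x} → hfs2nat-cong x }

module _ (U : ℕ) where

  nat2hfs-step : ∀ n → (∀ {m} → m < n → HFS U) → HFS U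
  nat2hfs-step n rec with n <? U
  ... | yes n<U = urelement (fromℕ< n<U)
  ... | no  _   = finset (mapWith∈ (nat2set (n ∸ U)) λ m∈ →
                    rec (<-≤-trans (∈-nat2set⇒< (n ∸ U) m∈) (m∸n≤m n U)))

  nat2hfs : ℕ → HFS U
  nat2hfs = <-rec (λ _ → HFS U) nat2hfs-step

  nat2hfs-unfold : ∀ n → nat2hfs n ≡ nat2hfs-step n (λ {m} _ → nat2hfs m)
  nat2hfs-unfold n =
    FixPoint.unfold-wfRec <-wellFounded (λ _ → HFS U) nat2hfs-step step-ext
    where
    step-ext : ∀ n {r r′ : ∀ {m} → m < n → HFS U} →
               (∀ {m} (m<n : m < n) → r m<n ≡ r′ m<n) →
               nat2hfs-step n r ≡ nat2hfs-step n r′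
    step-ext n r≗r′ with n <? U
    ... | yes _ = refl
    ... | no  _ = cong finset (mapWith∈-cong (nat2set (n ∸ U)) _ _ λ _ → r≗r′ _)

  nat2hfs-urelement : ∀ {n} (n<U : n < U) → nat2hfs n ≡ urelement (fromℕ< n<U)
  nat2hfs-urelement {n} n<U rewrite nat2hfs-unfold n with n <? U
  ... | yes _   = cong urelement (Fin.fromℕ<-cong n n refl _ _)
  ... | no  n≮U = contradiction n<U n≮U

  nat2hfs-finset : ∀ {n} → n ≥ U →
                   nat2hfs n ≡ finset (map nat2hfs (nat2set (n ∸ U)))
  nat2hfs-finset {n} n≥U rewrite nat2hfs-unfold n with n <? U
  ... | yes n<U = contradiction n<U (≤⇒≯ n≥U)
  ... | no  _   = cong finset (mapWith∈≗map nat2hfs (nat2set (n ∸ U)))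

  nat2hfsₛ : Func ℕₛ (HFSₛ U)
  nat2hfsₛ = record { to = nat2hfs ; cong = λ { refl → ≈-refl _ } }

{-# OPTIONS --safe #-}
module Submission where

-- Summing 2 ^ i over the ones of an expansion of n gives n, so nat2set is a right
-- inverse of set2nat.  It is two-sided because nat2set reaches every finite set:
-- an expansion with prescribed ones is built by switching on one digit at a time,
-- and its ones depend only on the number it represents.  The statements on HFS
-- then follow by ∈-induction in HFS and strong induction in ℕ.

open import Defs
open import Data.Digit using (Expansion; 0b; 1b; fromDigits; toDigits)
open import Data.Fin.Base as Fin using (zero; suc; toℕ)
open import Data.Fin.Properties as Fin using (fromℕ<-toℕ; toℕ-fromℕ<; toℕ<n)
open import Data.List.Base using (List; []; _∷_; map; findIndices)
open import Data.List.Membership.Propositional using (_∈_)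
open import Data.List.Membership.Propositional.Properties
  using (deduplicate-∈⇔; ∈-map⁻; ∈-map⁺)
open import Data.List.Membership.Propositional.Properties.WithK
  using (unique∧set⇒bag)
open import Data.List.Properties using (map-∘; map-id-local)
open import Data.List.Relation.Binary.BagAndSetEquality
  using (set; _∼[_]_; ∼bag⇒↭; ∷-cong; map-cong)
open import Data.List.Relation.Binary.Permutation.Propositional.Properties
  using (map⁺)
open import Data.List.Relation.Unary.All as All using (All; []; _∷_)
import Data.List.Relation.Unary.All.Properties as All
open import Data.List.Relation.Unary.Any using (here; there)
open import Data.List.Relation.Unary.Unique.DecPropositional.Properties
  using (deduplicate-!)
open import Data.List.Relation.Unary.Unique.Propositional using (Unique; []; _∷_)
import Data.List.Relation.Unary.Unique.Propositional.Properties as Unique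
open import Data.Nat using (ℕ; zero; suc; _+_; _*_; _∸_; _^_; _<_; _≟_)
open import Data.Nat.Induction using (<-rec)
open import Data.Nat.ListAction using (sum)
open import Data.Nat.ListAction.Properties using (sum-↭)
open import Data.Nat.Properties
  using (suc-injective; 0≢1+n; *-comm; *-cancelʳ-≡; *-distribʳ-+; even≢odd; m≤m+n;
         m+n∸m≡n; m+[n∸m]≡n; m∸n≤m; <-≤-trans; <-≤-connex)
open import Data.Product using (∃; _×_; _,_; proj₁; proj₂)
open import Data.Sum using (inj₁; inj₂)
open import Function.Bundles using (Equivalence; mk⇔)
import Function.Properties.Equivalence as ⇔
open import Relation.Binary.PropositionalEquality
  using (_≡_; _≢_; refl; sym; trans; cong; cong₂; subst; module ≡-Reasoning)
import Relation.Binary.Reasoning.Setoid as SetoidReasoning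
open import Relation.Nullary using (contradiction)

private
  variable
    U : ℕ

-- Positions of the ones in a binary expansion.

ones-0∷ : ∀ ds → ones (0b ∷ ds) ≡ map suc (ones ds)
-- Both sides fuse to one and the same map over `is`, since `toℕ (suc i)` reduces to `suc (toℕ i)`.
ones-0∷ ds = trans (sym (map-∘ is)) (map-∘ is)
  where is = findIndices (Fin._≟ 1b) ds

ones-1∷ : ∀ ds → ones (1b ∷ ds) ≡ 0 ∷ map suc (ones ds)
ones-1∷ ds = cong (0 ∷_) (ones-0∷ ds)

*2≢1+*2 : ∀ m n → m * 2 ≢ suc (n * 2)
*2≢1+*2 m n eq = even≢odd m n
  (trans (*-comm 2 m) (trans eq (cong suc (*-comm n 2))))

ones-0∷-cong : ∀ {ds es} → ones ds ≡ ones es → ones (0b ∷ ds) ≡ ones (0b ∷ es)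
ones-0∷-cong {ds} {es} eq =
  trans (ones-0∷ ds) (trans (cong (map suc) eq) (sym (ones-0∷ es)))

-- Expansions of the same number differ only in high-order zeros, which contribute no positions.
-- Parity fixes the lowest digit, and cancelling the factor 2 passes to the tails; `[]` behaves like
-- a list whose lowest digit is 0.
ones-fromDigits : ∀ ds es → fromDigits ds ≡ fromDigits es → ones ds ≡ ones es
ones-fromDigits []              []              _  = refl
ones-fromDigits []              (zero ∷ es)     eq = ones-0∷-cong {[]} {es}
  (ones-fromDigits [] es (*-cancelʳ-≡ 0 (fromDigits es) 2 eq))
ones-fromDigits (zero ∷ ds)     []             eq = ones-0∷-cong {ds} {[]}
  (ones-fromDigits ds [] (*-cancelʳ-≡ (fromDigits ds) 0 2 eq))
ones-fromDigits (zero ∷ ds)     (zero ∷ es)     eq = ones-0∷-cong {ds} {es}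
  (ones-fromDigits ds es (*-cancelʳ-≡ (fromDigits ds) (fromDigits es) 2 eq))
ones-fromDigits (suc zero ∷ ds) (suc zero ∷ es) eq = cong (0 ∷_) (ones-0∷-cong {ds} {es}
  (ones-fromDigits ds es
    (*-cancelʳ-≡ (fromDigits ds) (fromDigits es) 2 (suc-injective eq))))
ones-fromDigits (zero ∷ ds)     (suc zero ∷ es) eq =
  contradiction eq (*2≢1+*2 (fromDigits ds) (fromDigits es))
ones-fromDigits (suc zero ∷ ds) (zero ∷ es)     eq =
  contradiction (sym eq) (*2≢1+*2 (fromDigits es) (fromDigits ds))

nat2set-fromDigits : ∀ ds → nat2set (fromDigits ds) ≡ ones ds
nat2set-fromDigits ds = ones-fromDigits (proj₁ (toDigits 2 n)) ds (proj₂ (toDigits 2 n))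
  where n = fromDigits ds

-- Summing powers of two over the ones.

ones-! : ∀ ds → Unique (ones ds)
ones-! []             = []
ones-! (zero ∷ ds)     = subst Unique (sym (ones-0∷ ds))
  (Unique.map⁺ suc-injective (ones-! ds))
ones-! (suc zero ∷ ds) = subst Unique (sym (ones-1∷ ds))
  (All.map⁺ (All.universal (λ _ → 0≢1+n) (ones ds)) ∷ Unique.map⁺ suc-injective (ones-! ds))

-- Two duplicate-free lists with the same members are permutations of each other, and a sum is
-- invariant under permutation.
set2nat-! : ∀ {xs} → Unique xs → set2nat xs ≡ sum (map (2 ^_) xs)
set2nat-! {xs} xs! = sum-↭ (map⁺ (2 ^_) (∼bag⇒↭
  (unique∧set⇒bag (deduplicate-! _≟_ xs) xs! (⇔.sym (deduplicate-∈⇔ _≟_)))))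

sum-2^-map-suc : ∀ xs → sum (map (2 ^_) (map suc xs)) ≡ sum (map (2 ^_) xs) * 2
sum-2^-map-suc []       = refl
sum-2^-map-suc (x ∷ xs) = trans
  (cong₂ _+_ (*-comm 2 (2 ^ x)) (sum-2^-map-suc xs))
  (sym (*-distribʳ-+ 2 (2 ^ x) (sum (map (2 ^_) xs))))

-- `fromDigits` follows Horner's rule: putting a digit in front doubles the value of the tail, just
-- as raising every position by one doubles the sum of powers.
sum-2^-ones : ∀ ds → sum (map (2 ^_) (ones ds)) ≡ fromDigits ds
sum-2^-ones []              = refl
sum-2^-ones (zero ∷ ds)     = begin
  sum (map (2 ^_) (ones (0b ∷ ds)))     ≡⟨ cong (λ xs → sum (map (2 ^_) xs)) (ones-0∷ ds) ⟩
  sum (map (2 ^_) (map suc (ones ds)))  ≡⟨ sum-2^-map-suc (ones ds) ⟩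
  sum (map (2 ^_) (ones ds)) * 2        ≡⟨ cong (_* 2) (sum-2^-ones ds) ⟩
  fromDigits ds * 2                     ∎
  where open ≡-Reasoning
sum-2^-ones (suc zero ∷ ds) = begin
  sum (map (2 ^_) (ones (1b ∷ ds)))         ≡⟨ cong (λ xs → sum (map (2 ^_) xs)) (ones-1∷ ds) ⟩
  1 + sum (map (2 ^_) (map suc (ones ds)))  ≡⟨ cong suc (sum-2^-map-suc (ones ds)) ⟩
  1 + sum (map (2 ^_) (ones ds)) * 2        ≡⟨ cong (λ n → 1 + n * 2) (sum-2^-ones ds) ⟩
  1 + fromDigits ds * 2                     ∎
  where open ≡-Reasoning

set2nat-ones : ∀ ds → set2nat (ones ds) ≡ fromDigits ds
set2nat-ones ds = trans (set2nat-! (ones-! ds)) (sum-2^-ones ds)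

set2nat-nat2set : ∀ n → set2nat (nat2set n) ≡ n
set2nat-nat2set n = trans (set2nat-ones (proj₁ (toDigits 2 n))) (proj₂ (toDigits 2 n))

-- Expansions with prescribed ones.

∷-idem : ∀ (x : ℕ) xs → x ∷ xs ∼[ set ] x ∷ x ∷ xs
∷-idem x xs = mk⇔ there λ { (here eq) → here eq ; (there x∈) → x∈ }

∷-swap : ∀ (x y : ℕ) xs → x ∷ y ∷ xs ∼[ set ] y ∷ x ∷ xs
∷-swap x y xs = mk⇔ swap swap
  where
  swap : ∀ {x y z xs} → z ∈ x ∷ y ∷ xs → z ∈ y ∷ x ∷ xs
  swap (here eq)          = there (here eq)
  swap (there (here eq))  = here eq
  swap (there (there z∈)) = there (there z∈)

-- The digit is overwritten rather than `2 ^ n` added, so no carry arises and setting a digit twice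
-- is harmless.
setDigit : ℕ → Expansion 2 → Expansion 2
setDigit zero    []       = 1b ∷ []
setDigit zero    (_ ∷ ds) = 1b ∷ ds
setDigit (suc n) []       = 0b ∷ setDigit n []
setDigit (suc n) (d ∷ ds) = d ∷ setDigit n ds

-- This holds only as an equality of sets: `ones` lists positions in increasing order, and position
-- `n` may already be on.
ones-setDigit : ∀ n ds → ones (setDigit n ds) ∼[ set ] n ∷ ones ds
map-suc-ones-setDigit : ∀ n ds →
  map suc (ones (setDigit n ds)) ∼[ set ] suc n ∷ map suc (ones ds)

map-suc-ones-setDigit n ds = map-cong (λ _ → refl) (ones-setDigit n ds)

ones-setDigit zero    []              = ⇔.refl
ones-setDigit zero    (zero ∷ ds)     = ⇔.refl
-- The digit is already on, so only the right-hand side lists 0 twice.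
ones-setDigit zero    (suc zero ∷ ds) = ∷-idem 0 _
ones-setDigit (suc n) []              = begin
  ones (0b ∷ setDigit n [])       ≡⟨ ones-0∷ (setDigit n []) ⟩
  map suc (ones (setDigit n []))  ≈⟨ map-suc-ones-setDigit n [] ⟩
  suc n ∷ []                      ∎
  where open SetoidReasoning Pfinₛ
ones-setDigit (suc n) (zero ∷ ds)     = begin
  ones (0b ∷ setDigit n ds)       ≡⟨ ones-0∷ (setDigit n ds) ⟩
  map suc (ones (setDigit n ds))  ≈⟨ map-suc-ones-setDigit n ds ⟩
  suc n ∷ map suc (ones ds)       ≡⟨ cong (suc n ∷_) (ones-0∷ ds) ⟨
  suc n ∷ ones (0b ∷ ds)          ∎
  where open SetoidReasoning Pfinₛ
ones-setDigit (suc n) (suc zero ∷ ds) = begin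
  ones (1b ∷ setDigit n ds)           ≡⟨ ones-1∷ (setDigit n ds) ⟩
  0 ∷ map suc (ones (setDigit n ds))  ≈⟨ ∷-cong refl (map-suc-ones-setDigit n ds) ⟩
  0 ∷ suc n ∷ map suc (ones ds)       ≈⟨ ∷-swap 0 (suc n) (map suc (ones ds)) ⟩
  suc n ∷ 0 ∷ map suc (ones ds)       ≡⟨ cong (suc n ∷_) (ones-1∷ ds) ⟨
  suc n ∷ ones (1b ∷ ds)              ∎
  where open SetoidReasoning Pfinₛ

ones-surjective : ∀ xs → ∃ λ ds → ones ds ∼[ set ] xs
ones-surjective []       = [] , ⇔.refl
ones-surjective (x ∷ xs) =
  let ds , ds∼xs = ones-surjective xs
  in setDigit x ds , ⇔.trans (ones-setDigit x ds) (∷-cong refl ds∼xs)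

nat2set-set2nat : ∀ xs → nat2set (set2nat xs) ∼[ set ] xs
nat2set-set2nat xs = let ds , ds∼xs = ones-surjective xs in begin
  -- Replacing `xs` by the ones of `ds` makes `set2nat` computable as `fromDigits ds`.
  nat2set (set2nat xs)         ≡⟨ cong nat2set (set2nat-cong ds∼xs) ⟨
  nat2set (set2nat (ones ds))  ≡⟨ cong nat2set (set2nat-ones ds) ⟩
  nat2set (fromDigits ds)      ≡⟨ nat2set-fromDigits ds ⟩
  ones ds                      ≈⟨ ds∼xs ⟩
  xs                           ∎
  where open SetoidReasoning Pfinₛ

-- Hereditarily finite sets.

hfs2nat-nat2hfs : ∀ U n → hfs2nat (nat2hfs U n) ≡ n
hfs2nat-nat2hfs U = <-rec (λ n → hfs2nat (nat2hfs U n) ≡ n) step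
  where
  step : ∀ n → (∀ {m} → m < n → hfs2nat (nat2hfs U m) ≡ m) → hfs2nat (nat2hfs U n) ≡ n
  step n ih with <-≤-connex n U
  ... | inj₁ n<U = trans (cong hfs2nat (nat2hfs-urelement U n<U)) (toℕ-fromℕ< n<U)
  ... | inj₂ n≥U = begin
    hfs2nat (nat2hfs U n)                               ≡⟨ cong hfs2nat (nat2hfs-finset U n≥U) ⟩
    hfs2nat (finset (map (nat2hfs U) ms))               ≡⟨ hfs2nat-finset (map (nat2hfs U) ms) ⟩
    U + set2nat (map hfs2nat (map (nat2hfs U) ms))      ≡⟨ cong (λ xs → U + set2nat xs) (map-∘ ms) ⟨
    U + set2nat (map (λ m → hfs2nat (nat2hfs U m)) ms)  ≡⟨ cong (λ xs → U + set2nat xs) (map-id-local fixed) ⟩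
    U + set2nat ms                                      ≡⟨ cong (U +_) (set2nat-nat2set (n ∸ U)) ⟩
    -- Truncated subtraction is exact here because `U` is at most `n`.
    U + (n ∸ U)                                         ≡⟨ m+[n∸m]≡n n≥U ⟩
    n                                                   ∎
    where
    open ≡-Reasoning
    ms = nat2set (n ∸ U)
    fixed : All (λ m → hfs2nat (nat2hfs U m) ≡ m) ms
    -- A one-position of `n ∸ U` is smaller than `n ∸ U`, hence smaller than `n`.
    fixed = All.tabulate λ m∈ → ih (<-≤-trans (∈-nat2set⇒< (n ∸ U) m∈) (m∸n≤m n U))

-- Allowing any `ms` with the right members matters because `nat2set` returns the codes in its own
-- order and without repetitions.
finset-map-hfs2nat : {xs : List (HFS U)} {ms : List ℕ} →
                     All (λ x → nat2hfs U (hfs2nat x) ≈ x) xs →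
                     ms ∼[ set ] map hfs2nat xs →
                     finset (map (nat2hfs U) ms) ≈ finset xs
finset-map-hfs2nat {U} {xs} {ms} xs-fixed ms∼xs = finset to from
  where
  to : ∀ {y} → y ∈ map (nat2hfs U) ms → ∃ λ x → x ∈ xs × y ≈ x
  to y∈ with ∈-map⁻ (nat2hfs U) y∈
  -- The member of `ms` behind `y` is the code of some `x` in `xs`, so `y` is
  -- `nat2hfs U (hfs2nat x)`.
  ... | _ , m∈ , refl with ∈-map⁻ hfs2nat (Equivalence.to ms∼xs m∈)
  ... | x , x∈ , refl = x , x∈ , All.lookup xs-fixed x∈

  from : ∀ {x} → x ∈ xs → ∃ λ y → y ∈ map (nat2hfs U) ms × y ≈ x
  from x∈ = _ , ∈-map⁺ (nat2hfs U) (Equivalence.from ms∼xs (∈-map⁺ hfs2nat x∈)) ,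
            All.lookup xs-fixed x∈

-- The offset `U` separates the codes: those of urelements lie below it and those of sets do not, so
-- decoding takes the branch that encoding came from.
nat2hfs-hfs2nat : (x : HFS U) → nat2hfs U (hfs2nat x) ≈ x
nat2hfs-hfs2nat {U} = HFS-ind _ atom step
  where
  open SetoidReasoning (HFSₛ U)

  atom : ∀ a → nat2hfs U (toℕ a) ≈ urelement a
  atom a = begin
    nat2hfs U (toℕ a)                 ≡⟨ nat2hfs-urelement U (toℕ<n a) ⟩
    urelement (Fin.fromℕ< (toℕ<n a))  ≡⟨ cong urelement (fromℕ<-toℕ a (toℕ<n a)) ⟩
    urelement a                       ∎

  step : ∀ xs → All (λ x → nat2hfs U (hfs2nat x) ≈ x) xs →
         nat2hfs U (hfs2nat (finset xs)) ≈ finset xs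
  step xs ih = begin
    nat2hfs U (hfs2nat (finset xs))                 ≡⟨ cong (nat2hfs U) (hfs2nat-finset xs) ⟩
    nat2hfs U (U + n)                               ≡⟨ nat2hfs-finset U (m≤m+n U n) ⟩
    finset (map (nat2hfs U) (nat2set (U + n ∸ U)))  ≡⟨ cong (λ k → finset (map (nat2hfs U) (nat2set k))) (m+n∸m≡n U n) ⟩
    finset (map (nat2hfs U) (nat2set n))            ≈⟨ finset-map-hfs2nat ih (nat2set-set2nat (map hfs2nat xs)) ⟩
    finset xs                                       ∎
    where n = set2nat (map hfs2nat xs)

proposition2 : (U : ℕ) →
    (nat2setₛ ∘ₛ set2natₛ ≗ₛ idₛ Pfinₛ) ×
    (set2natₛ ∘ₛ nat2setₛ ≗ₛ idₛ ℕₛ) ×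
    (nat2hfsₛ U ∘ₛ hfs2natₛ U ≗ₛ idₛ (HFSₛ U)) ×
    (hfs2natₛ U ∘ₛ nat2hfsₛ U ≗ₛ idₛ ℕₛ)
proposition2 U =
  (λ xs → nat2set-set2nat xs) , set2nat-nat2set , nat2hfs-hfs2nat , hfs2nat-nat2hfs U
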